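{- There exist absolute constants $c, C>0$ with the following property. For every $m_0$ there exist an integer $m\ge m_0$, a set $\mathcal{A}$ of $m$ positive integers, and a graph $G_m$ with vertex set $\mathcal{A}$ and at least $c\, m^{5/3}/\log^{1/3} m$ edges such that $$|\mathcal{A}+_{G_m}\mathcal{A}|+|\mathcal{A}\cdot_{G_m}\mathcal{A}|\le C\,(|\mathcal{A}|\log|\mathcal{A}|)^{4/3}.$$
   Context: For a finite set $\mathcal{A}$ of numbers and a graph $G$ whose vertices are the elements of $\mathcal{A}$, the sumset along $G$ is $\mathcal{A}+_{G}\mathcal{A}=\{a+b : \{a,b\}\in E(G)\}$ and the product set along $G$ is $\mathcal{A}\cdot_{G}\mathcal{A}=\{ab : \{a,b\}\in E(G)\}$. -}

module Defs where

open import Data.Nat using (ℕ; _+_; _*_; _<_; NonZero)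
open import Data.Nat.Properties using (_≟_)
open import Data.Fin using (Fin)
open import Data.Fin.Properties renaming (_≟_ to _≟F_)
open import Data.Product using (_×_; _,_; proj₁; proj₂)
open import Data.List using (List; map; length; deduplicate)
open import Data.List.Relation.Unary.All using (All)
open import Data.List.Relation.Unary.Unique.Propositional using (Unique)
open import Function.Definitions using (Injective)
open import Relation.Binary.PropositionalEquality using (_≡_)

record PosIntSet (m : ℕ) : Set where
  field
    elt      : Fin m → ℕ
    injective : Injective _≡_ _≡_ elt
    positive : ∀ i → NonZero (elt i)
open PosIntSet public

-- A (simple) graph on vertex set Fin m (i.e. on 𝒜 via elt), given by its
-- edge list: each edge {i,j} is stored once as (i , j) with i < j, and no
-- edge appears twice.  The number of edges is the length of the list.
record Graph (m : ℕ) : Set where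
  field
    edges   : List (Fin m × Fin m)
    ordered : All (λ e → Data.Fin._<_ (proj₁ e) (proj₂ e)) edges
    noDup   : Unique edges
open Graph public

numEdges : ∀ {m} → Graph m → ℕ
numEdges G = length (edges G)

card : List ℕ → ℕ
card xs = length (deduplicate _≟_ xs)

sumsAlong : ∀ {m} → PosIntSet m → Graph m → List ℕ
sumsAlong A G = map (λ e → elt A (proj₁ e) + elt A (proj₂ e)) (edges G)

prodsAlong : ∀ {m} → PosIntSet m → Graph m → List ℕ
prodsAlong A G = map (λ e → elt A (proj₁ e) * elt A (proj₂ e)) (edges G)

{-# OPTIONS --safe #-}
module Submission where

-- The vertices are dilated rationals u·w/v and u′·v/w, where w/v runs over the R ≍ N²
-- reduced fractions of height at most N and u, u′ run over K = N⁴ values each; each fraction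
-- w/v carries a complete bipartite graph.  A product u·u′ forgets w/v, so there are at most
-- K² = N⁸ products.  A sum is (u·w² + u′·v²)/(v·w), so each fraction contributes O(K·N²)
-- sums when u and u′ run over progressions with a common difference, O(N⁸) in total.
-- Taking u ≡ 1 and u′ ≡ T = N² + 1 modulo P = T² makes all 2·R·K ≍ N⁶ vertices distinct:
-- cross-multiplying a coincidence and reducing modulo P leaves an equality of the fractions
-- alone.  There are R·K² ≍ N¹⁰ edges, and R ≥ N²/4 because Σ_{g≥2} 1/g² ≤ 3/4.

open import Defs
open import Data.Fin as Fin using (Fin; zero; suc; toℕ; splitAt; combine; remQuot; _↑ˡ_; _↑ʳ_)
open import Data.Fin.Properties using (injective⇒≤; toℕ<n; toℕ-injective; toℕ-↑ˡ; toℕ-↑ʳ; splitAt-↑ˡ; splitAt-↑ʳ; splitAt⁻¹-↑ˡ; splitAt⁻¹-↑ʳ; remQuot-combine; combine-remQuot; combine-injective; ↑ˡ-injective; ↑ʳ-injective)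
open import Data.List using (List; []; _∷_; _++_; map; length; lookup; filter; upTo; applyUpTo; allFin; cartesianProduct)
open import Data.List.Membership.Propositional using (_∈_)
open import Data.List.Membership.Propositional.Properties using (∈-lookup; ∈-map⁺; ∈-map⁻; ∈-++⁺ˡ; ∈-++⁺ʳ; ∈-filter⁺; ∈-filter⁻; ∈-allFin; ∈-upTo⁺; ∈-applyUpTo⁺; ∈-applyUpTo⁻; ∈-cartesianProduct⁺; ∈-cartesianProduct⁻; ∈-deduplicate⁻)
open import Data.List.Properties using (length-map; length-++; length-applyUpTo; length-upTo; length-tabulate; length-filter)
open import Data.List.Relation.Binary.Subset.Propositional using (_⊆_)
import Data.List.Relation.Unary.All as All
open import Data.List.Relation.Unary.AllPairs using (_∷_)
open import Data.List.Relation.Unary.Any using (index)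
open import Data.List.Relation.Unary.Any.Properties using (lookup-index)
open import Data.List.Relation.Unary.Unique.Propositional using (Unique)
open import Data.List.Relation.Unary.Unique.DecPropositional.Properties using (deduplicate-!)
import Data.List.Relation.Unary.Unique.Propositional.Properties as Unique
open import Data.Nat using (ℕ; zero; suc; _+_; _*_; _^_; _≤_; _<_; z≤n; s≤s; _/_; _%_; _!; NonZero; >-nonZero; >-nonZero⁻¹)
open import Data.Nat.Coprimality as Coprimality using (Coprime; coprime?; coprime-divisor; gcd≡1⇒coprime)
open import Data.Nat.Divisibility using (_∣_; divides; ∣-antisym; ∣-trans; m∣m*n; n∣m*n; m≤n⇒m!∣n!; ∣⇒≤)
open import Data.Nat.DivMod using (m/n*n≤m; m*[n/m]≡n; [m+kn]%n≡m%n; m<n⇒m%n≡m; /-monoˡ-≤; m*n/n≡m)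
open import Data.Nat.GCD using (gcd; gcd[m,n]∣m; gcd[m,n]∣n)
open import Data.Nat.Logarithm using (⌊log₂_⌋; ⌊log₂⌋-mono-≤)
open import Data.Nat.Properties
open import Data.Nat.Solver using (module +-*-Solver)
open import Data.Nat.Tactic.RingSolver using (solve-∀)
open import Data.Product using (_×_; _,_; proj₁; proj₂; uncurry; ∃-syntax)
open import Data.Sum using (_⊎_; inj₁; inj₂; [_,_])
open import Function using (_∘_; id)
open import Function.Definitions using (Injective)
open import Relation.Binary.PropositionalEquality using (_≡_; _≢_; refl; sym; trans; cong; cong₂; subst; module ≡-Reasoning)
open import Relation.Nullary using (yes; no; contradiction)

-- Counting distinct elements by pigeonhole

lookup-injective : {A : Set} {xs : List A} → Unique xs → Injective _≡_ _≡_ (lookup xs)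
lookup-injective (x∉ ∷ u) {zero}  {zero}  _  = refl
lookup-injective (x∉ ∷ u) {zero}  {suc j} eq = contradiction eq (All.lookup x∉ (∈-lookup j))
lookup-injective (x∉ ∷ u) {suc i} {zero}  eq = contradiction (sym eq) (All.lookup x∉ (∈-lookup i))
lookup-injective (x∉ ∷ u) {suc i} {suc j} eq = cong suc (lookup-injective u eq)

-- Pigeonhole: each position in `xs` goes to a position of its value in `ys`. Positions that collide
-- carry equal values, and uniqueness of `xs` then identifies them. Repetitions in `ys` are
-- harmless, so a covering list may overcount.
Unique-⊆⇒length≤ : {A : Set} {xs ys : List A} → Unique xs → xs ⊆ ys → length xs ≤ length ys
Unique-⊆⇒length≤ {xs = xs} {ys} u xs⊆ys = injective⇒≤ λ {i} {j} eq →
  lookup-injective u (trans (position i) (trans (cong (lookup ys) eq) (sym (position j))))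
  where
  position : ∀ i → lookup xs i ≡ lookup ys (index (xs⊆ys (∈-lookup i)))
  position i = lookup-index (xs⊆ys (∈-lookup i))

card≤length : ∀ {xs ys} → xs ⊆ ys → card xs ≤ length ys
card≤length {xs} xs⊆ys =
  Unique-⊆⇒length≤ (deduplicate-! _≟_ xs) (xs⊆ys ∘ ∈-deduplicate⁻ _≟_ xs)

length-cartesianProduct : {A B : Set} (xs : List A) (ys : List B) →
  length (cartesianProduct xs ys) ≡ length xs * length ys
length-cartesianProduct []       ys = refl
length-cartesianProduct (x ∷ xs) ys = trans (length-++ (map (x ,_) ys))
  (cong₂ _+_ (length-map (x ,_) ys) (length-cartesianProduct xs ys))

length-allFin : ∀ n → length (allFin n) ≡ n
length-allFin n = length-tabulate id

-- Coprime pairs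

box : ℕ → List (ℕ × ℕ)
box n = cartesianProduct (applyUpTo suc n) (applyUpTo suc n)

length-box : ∀ n → length (box n) ≡ n * n
length-box n = trans (length-cartesianProduct (applyUpTo suc n) (applyUpTo suc n))
  (cong₂ _*_ (length-applyUpTo suc n) (length-applyUpTo suc n))

∈-range⁺ : ∀ {n x} → 1 ≤ x → x ≤ n → x ∈ applyUpTo suc n
∈-range⁺ {x = suc _} _ x≤n = ∈-applyUpTo⁺ suc x≤n

∈-range⁻ : ∀ {n x} → x ∈ applyUpTo suc n → 1 ≤ x × x ≤ n
∈-range⁻ x∈ with _ , i<n , refl ← ∈-applyUpTo⁻ suc x∈ = s≤s z≤n , i<n

∈-box⁻ : ∀ n {x y} → (x , y) ∈ box n → (1 ≤ x × x ≤ n) × (1 ≤ y × y ≤ n)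
∈-box⁻ n xy∈ with x∈ , y∈ ← ∈-cartesianProduct⁻ (applyUpTo suc n) (applyUpTo suc n) xy∈ =
  ∈-range⁻ x∈ , ∈-range⁻ y∈

box-unique : ∀ n → Unique (box n)
box-unique n = Unique.cartesianProduct⁺ range-unique range-unique
  where
  range-unique : Unique (applyUpTo suc n)
  range-unique = Unique.applyUpTo⁺₁ suc n λ i<j _ eq → <⇒≢ i<j (suc-injective eq)

coprimePairs : ℕ → List (ℕ × ℕ)
coprimePairs n = filter (uncurry coprime?) (box n)

coprimePairs-unique : ∀ n → Unique (coprimePairs n)
coprimePairs-unique n = Unique.filter⁺ (uncurry coprime?) (box-unique n)

length-coprimePairs≤ : ∀ n → length (coprimePairs n) ≤ n * n
length-coprimePairs≤ n = subst (length (coprimePairs n) ≤_) (length-box n)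
  (length-filter (uncurry coprime?) (box n))

dilate : ℕ → ℕ × ℕ → ℕ × ℕ
dilate g (x , y) = x * g , y * g

-- The pairs in box n having a common divisor in {2, …, j + 1}, with repetitions.
commonMultiples : ℕ → ℕ → List (ℕ × ℕ)
commonMultiples n zero    = []
commonMultiples n (suc j) = map (dilate (2 + j)) (box (n / (2 + j))) ++ commonMultiples n j

∈-commonMultiples : ∀ n {i j p} → i < j → p ∈ box (n / (2 + i)) →
                    dilate (2 + i) p ∈ commonMultiples n j
∈-commonMultiples n {i} {suc j} i<1+j p∈ with i ≟ j
... | yes refl = ∈-++⁺ˡ (∈-map⁺ (dilate (2 + j)) p∈)
... | no i≢j   = ∈-++⁺ʳ (map (dilate (2 + j)) (box (n / (2 + j))))
                   (∈-commonMultiples n (≤∧≢⇒< (≤-pred i<1+j) i≢j) p∈)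

∈-range-quotient : ∀ {n x g} .{{_ : NonZero g}} q → x ≡ q * g → 1 ≤ x → x ≤ n →
                   q ∈ applyUpTo suc (n / g)
∈-range-quotient {g = g} zero refl () _
∈-range-quotient {n} {g = g} q@(suc _) refl _ x≤n =
  ∈-range⁺ (s≤s z≤n) (subst (_≤ n / g) (m*n/n≡m q g) (/-monoˡ-≤ g x≤n))

-- Dividing by `g = gcd x y` decides the side: `g = 1` is the coprime case, while `g = i + 2` leaves
-- a pair of quotients in the box of side `n / g`. Since `g` divides `x`, it is at most `n`, so its
-- index `i` lies below `n`.
box⊆coprime++common : ∀ n → box n ⊆ coprimePairs n ++ commonMultiples n n
box⊆coprime++common n {x , y} xy∈
  with (1≤x , x≤n) , (1≤y , y≤n) ← ∈-box⁻ n xy∈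
  with gcd x y in eq | gcd[m,n]∣m x y | gcd[m,n]∣n x y
... | 0 | divides q x≡ | _ =
  contradiction (trans x≡ (*-zeroʳ q)) (>⇒≢ 1≤x)
... | 1 | _ | _ = ∈-++⁺ˡ (∈-filter⁺ (uncurry coprime?) xy∈ (gcd≡1⇒coprime eq))
... | suc (suc i) | g∣x@(divides q x≡) | divides r y≡ =
  ∈-++⁺ʳ (coprimePairs n)
    (subst (_∈ commonMultiples n n) (sym (cong₂ _,_ x≡ y≡))
      (∈-commonMultiples n i<n
        (∈-cartesianProduct⁺ (∈-range-quotient q x≡ 1≤x x≤n) (∈-range-quotient r y≡ 1≤y y≤n))))
  where
  i<n : i < n
  i<n = ≤-trans (≤-trans (n≤1+n (suc i)) (∣⇒≤ {{>-nonZero 1≤x}} g∣x)) x≤n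

-- The telescoping bound 1/(K+1)² ≤ 1/K − 1/(K+1).
telescope : ∀ K .{{_ : NonZero K}} S f n → 4 * K * S + 4 * (n * n) ≤ 3 * K * (n * n) → f * suc K ≤ n →
            4 * suc K * (f * f + S) + 4 * (n * n) ≤ 3 * suc K * (n * n)
telescope K S f n ih fK≤n = *-cancelˡ-≤ K (+-cancelʳ-≤ (4 * suc K * (n * n)) _ _ (begin
  K * (4 * suc K * (f * f + S) + 4 * (n * n)) + 4 * suc K * (n * n)
    ≡⟨ regroup K S f (n * n) ⟩
  suc K * (4 * K * S + 4 * (n * n)) + 4 * (f * K * (f * suc K)) + 4 * K * (n * n)
    ≤⟨ +-monoˡ-≤ (4 * K * (n * n)) (+-mono-≤ (*-monoʳ-≤ (suc K) ih)
         (*-monoʳ-≤ 4 (*-mono-≤ (≤-trans (*-monoʳ-≤ f (n≤1+n K)) fK≤n) fK≤n))) ⟩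
  suc K * (3 * K * (n * n)) + 4 * (n * n) + 4 * K * (n * n)
    ≡⟨ collect K (n * n) ⟩
  K * (3 * suc K * (n * n)) + 4 * suc K * (n * n) ∎))
  where
  open ≤-Reasoning
  regroup : ∀ K S f q → K * (4 * suc K * (f * f + S) + 4 * q) + 4 * suc K * q
            ≡ suc K * (4 * K * S + 4 * q) + 4 * (f * K * (f * suc K)) + 4 * K * q
  regroup = solve-∀
  collect : ∀ K q → suc K * (3 * K * q) + 4 * q + 4 * K * q ≡ K * (3 * suc K * q) + 4 * suc K * q
  collect = solve-∀

length-commonMultiples-suc : ∀ n j → length (commonMultiples n (suc j)) ≡
  n / (2 + j) * (n / (2 + j)) + length (commonMultiples n j)
length-commonMultiples-suc n j = trans (length-++ (map (dilate (2 + j)) (box (n / (2 + j)))))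
  (cong (_+ length (commonMultiples n j))
    (trans (length-map (dilate (2 + j)) (box (n / (2 + j)))) (length-box (n / (2 + j)))))

-- With `K = j + 2` the largest divisor counted, this is the bound `(3/4 - 1/K) * n²` on the length,
-- cleared of denominators. At `K = 2` it reads `n²/4`, which `(n / 2)²` satisfies; each further
-- divisor is absorbed by the telescoping step.
commonMultiples-bound : ∀ n j →
  4 * (2 + j) * length (commonMultiples n (suc j)) + 4 * (n * n) ≤ 3 * (2 + j) * (n * n)
commonMultiples-bound n zero rewrite length-commonMultiples-suc n 0 = begin
  8 * (f * f + 0) + 4 * (n * n)   ≡⟨ cong (_+ 4 * (n * n)) (double f) ⟩
  2 * (f * 2 * (f * 2)) + 4 * (n * n)
    ≤⟨ +-monoˡ-≤ (4 * (n * n)) (*-monoʳ-≤ 2 (*-mono-≤ (m/n*n≤m n 2) (m/n*n≤m n 2))) ⟩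
  2 * (n * n) + 4 * (n * n)       ≡⟨ *-distribʳ-+ (n * n) 2 4 ⟨
  6 * (n * n)                     ∎
  where
  open ≤-Reasoning
  f = n / 2
  double : ∀ f → 8 * (f * f + 0) ≡ 2 * (f * 2 * (f * 2))
  double = solve-∀
commonMultiples-bound n (suc j) rewrite length-commonMultiples-suc n (suc j) =
  telescope (2 + j) (length (commonMultiples n (suc j))) (n / (3 + j)) n
    (commonMultiples-bound n j) (m/n*n≤m n (3 + j))

length-commonMultiples≤ : ∀ n → 4 * length (commonMultiples n n) ≤ 3 * (n * n)
length-commonMultiples≤ zero      = z≤n
length-commonMultiples≤ n@(suc j) = *-cancelʳ-≤ _ _ (2 + j) (begin
  4 * length (commonMultiples n n) * (2 + j)
    ≡⟨ swap 4 (length (commonMultiples n n)) (2 + j) ⟩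
  4 * (2 + j) * length (commonMultiples n n)
    -- The telescoping remainder `n²/(n + 1)` is discarded, leaving the constant `3/4`.
    ≤⟨ m≤m+n _ _ ⟩
  4 * (2 + j) * length (commonMultiples n n) + 4 * (n * n)
    ≤⟨ commonMultiples-bound n j ⟩
  3 * (2 + j) * (n * n)
    ≡⟨ swap 3 (n * n) (2 + j) ⟨
  3 * (n * n) * (2 + j) ∎)
  where
  open ≤-Reasoning
  swap : ∀ a b c → a * b * c ≡ a * c * b
  swap = solve-∀

length-coprimePairs≥ : ∀ n → n * n ≤ 4 * length (coprimePairs n)
length-coprimePairs≥ n = +-cancelʳ-≤ (3 * (n * n)) _ _ (begin
  4 * (n * n)                        ≡⟨ cong (4 *_) (length-box n) ⟨
  4 * length (box n)
    ≤⟨ *-monoʳ-≤ 4 (Unique-⊆⇒length≤ (box-unique n) (box⊆coprime++common n)) ⟩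
  4 * length (coprimePairs n ++ commonMultiples n n)
    ≡⟨ cong (4 *_) (length-++ (coprimePairs n)) ⟩
  4 * (length (coprimePairs n) + length (commonMultiples n n))
    ≡⟨ *-distribˡ-+ 4 (length (coprimePairs n)) (length (commonMultiples n n)) ⟩
  4 * length (coprimePairs n) + 4 * length (commonMultiples n n)
    ≤⟨ +-monoʳ-≤ (4 * length (coprimePairs n)) (length-commonMultiples≤ n) ⟩
  4 * length (coprimePairs n) + 3 * (n * n) ∎)
  where open ≤-Reasoning

-- Reduced fractions are determined by their value: by Euclid's lemma the two numerators divide each
-- other, and so do the two denominators.
cross-multiplication-injective : ∀ {n d n′ d′} → Coprime n d → Coprime n′ d′ →
                                 n * d′ ≡ n′ * d → n ≡ n′ × d ≡ d′
cross-multiplication-injective {n} {d} {n′} {d′} c c′ eq =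
  ∣-antisym (coprime-divisor {n} {d} {n′} c
              (subst (n ∣_) (trans eq (*-comm n′ d)) (m∣m*n d′)))
            (coprime-divisor {n′} {d′} {n} c′
              (subst (n′ ∣_) (trans (sym eq) (*-comm n d′)) (m∣m*n d))) ,
  ∣-antisym (coprime-divisor {d} {n} {d′} (Coprimality.sym {n} {d} c)
              (subst (d ∣_) (sym eq) (n∣m*n n′)))
            (coprime-divisor {d′} {n′} {d} (Coprimality.sym {n′} {d′} c′)
              (subst (d′ ∣_) eq (n∣m*n n)))

-- Disjoint unions of complete bipartite graphs

module BipartiteBlocks
  (R K : ℕ) (left right : Fin R → Fin K → ℕ)
  (left-injective  : ∀ {i k j l} → left i k ≡ left j l → i ≡ j × k ≡ l)
  (right-injective : ∀ {i k j l} → right i k ≡ right j l → i ≡ j × k ≡ l)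
  (left≢right      : ∀ {i k j l} → left i k ≢ right j l)
  (left-positive   : ∀ i k → NonZero (left i k))
  (right-positive  : ∀ i k → NonZero (right i k))
  where

  order : ℕ
  order = R * K + R * K

  value : Fin (R * K) ⊎ Fin (R * K) → ℕ
  value = [ uncurry left ∘ remQuot {R} K , uncurry right ∘ remQuot {R} K ]

  remQuot-injective : ∀ {x y : Fin (R * K)} → proj₁ (remQuot {R} K x) ≡ proj₁ (remQuot {R} K y) ×
                      proj₂ (remQuot {R} K x) ≡ proj₂ (remQuot {R} K y) → x ≡ y
  remQuot-injective {x} {y} (eq₁ , eq₂) =
    trans (sym (combine-remQuot {R} K x)) (trans (cong₂ combine eq₁ eq₂) (combine-remQuot {R} K y))

  value-injective : Injective _≡_ _≡_ value
  value-injective {inj₁ x} {inj₁ y} eq = cong inj₁ (remQuot-injective (left-injective eq))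
  value-injective {inj₁ x} {inj₂ y} eq = contradiction eq left≢right
  value-injective {inj₂ x} {inj₁ y} eq = contradiction (sym eq) left≢right
  value-injective {inj₂ x} {inj₂ y} eq = cong inj₂ (remQuot-injective (right-injective eq))

  value-positive : ∀ x → NonZero (value x)
  value-positive (inj₁ x) = left-positive _ _
  value-positive (inj₂ y) = right-positive _ _

  splitAt-injective : Injective _≡_ _≡_ (splitAt (R * K) {R * K})
  splitAt-injective {x} {y} eq with splitAt (R * K) {R * K} x in eqx | splitAt (R * K) {R * K} y in eqy
  splitAt-injective refl | inj₁ _ | inj₁ _ = trans (sym (splitAt⁻¹-↑ˡ eqx)) (splitAt⁻¹-↑ˡ eqy)
  splitAt-injective refl | inj₂ _ | inj₂ _ =
    trans (sym (splitAt⁻¹-↑ʳ {R * K} eqx)) (splitAt⁻¹-↑ʳ {R * K} eqy)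

  vertexSet : PosIntSet order
  vertexSet .elt       = value ∘ splitAt (R * K)
  vertexSet .injective = splitAt-injective ∘ value-injective
  vertexSet .positive  = value-positive ∘ splitAt (R * K)

  EdgeIndex : Set
  EdgeIndex = Fin R × Fin K × Fin K

  -- Left vertices occupy the first `R * K` indices and right vertices the last `R * K`, so every
  -- edge lists its smaller endpoint first.
  edge : EdgeIndex → Fin order × Fin order
  edge (i , k , l) = combine i k ↑ˡ (R * K) , (R * K) ↑ʳ combine i l

  edge-ordered : ∀ e → proj₁ (edge e) Fin.< proj₂ (edge e)
  edge-ordered (i , k , l)
    rewrite toℕ-↑ˡ (combine i k) (R * K) | toℕ-↑ʳ (R * K) (combine i l) =
    <-≤-trans (toℕ<n (combine i k)) (m≤m+n (R * K) _)

  edge-injective : ∀ {e e′} → edge e ≡ edge e′ → e ≡ e′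
  edge-injective {i , k , l} {i′ , k′ , l′} eq
    with refl , refl ← combine-injective i k i′ k′ (↑ˡ-injective (R * K) _ _ (cong proj₁ eq))
    with _ , refl ← combine-injective i l i l′ (↑ʳ-injective (R * K) _ _ (cong proj₂ eq)) = refl

  edgeIndices : List EdgeIndex
  edgeIndices = cartesianProduct (allFin R) (cartesianProduct (allFin K) (allFin K))

  graph : Graph order
  graph .edges   = map edge edgeIndices
  graph .ordered = All.tabulate λ e∈ → let e , _ , eq = ∈-map⁻ edge e∈ in
    subst (λ e → proj₁ e Fin.< proj₂ e) (sym eq) (edge-ordered e)
  graph .noDup   = Unique.map⁺ edge-injective
    (Unique.cartesianProduct⁺ (Unique.allFin⁺ R)
      (Unique.cartesianProduct⁺ (Unique.allFin⁺ K) (Unique.allFin⁺ K)))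

  numEdges-graph : numEdges graph ≡ R * (K * K)
  numEdges-graph = trans (length-map edge edgeIndices)
    (trans (length-cartesianProduct (allFin R) _)
      (cong₂ _*_ (length-allFin R)
        (trans (length-cartesianProduct (allFin K) (allFin K))
          (cong₂ _*_ (length-allFin K) (length-allFin K)))))

  elt-left : ∀ i k → elt vertexSet (combine i k ↑ˡ (R * K)) ≡ left i k
  elt-left i k = trans (cong value (splitAt-↑ˡ (R * K) (combine i k) (R * K)))
    (cong (uncurry left) (remQuot-combine i k))

  elt-right : ∀ i l → elt vertexSet ((R * K) ↑ʳ combine i l) ≡ right i l
  elt-right i l = trans (cong value (splitAt-↑ʳ (R * K) (R * K) (combine i l)))
    (cong (uncurry right) (remQuot-combine i l))

  -- The operation is kept arbitrary so that one statement serves both the sumset and the product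
  -- set.
  alongEdges-⊆ : ∀ (_∙_ : ℕ → ℕ → ℕ) {ys} → (∀ i k l → (left i k ∙ right i l) ∈ ys) →
    map (λ e → elt vertexSet (proj₁ e) ∙ elt vertexSet (proj₂ e)) (edges graph) ⊆ ys
  alongEdges-⊆ _∙_ {ys} hyp x∈
    with _ , e∈ , refl ← ∈-map⁻ _ x∈
    with (i , k , l) , _ , refl ← ∈-map⁻ edge e∈ =
    subst (_∈ ys) (sym (cong₂ _∙_ (elt-left i k) (elt-right i l))) (hyp i k l)

-- Dilated fractions as vertices, and their distinctness

residue-unique : ∀ {P X Y} .{{_ : NonZero P}} a b → X < P → Y < P → X + a * P ≡ Y + b * P → X ≡ Y
residue-unique {P} {X} {Y} a b X<P Y<P eq = begin
  X               ≡⟨ m<n⇒m%n≡m X<P ⟨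
  X % P           ≡⟨ [m+kn]%n≡m%n X a P ⟨
  (X + a * P) % P ≡⟨ cong (_% P) eq ⟩
  (Y + b * P) % P ≡⟨ [m+kn]%n≡m%n Y b P ⟩
  Y % P           ≡⟨ m<n⇒m%n≡m Y<P ⟩
  Y               ∎
  where open ≡-Reasoning

module Construction (N : ℕ) .{{_ : NonZero N}} where

  -- `F` clears every denominator up to `N`. `K = Q * Q` balances the sum count, of order
  -- `Q * (K * Q)`, against the product count `K * K`. `T` exceeds every product of two numbers up
  -- to `N`, and `P = T * T` exceeds `T` times such a product.
  F Q K T P R : ℕ
  F = N !
  Q = N * N
  K = Q * Q
  T = suc Q
  P = T * T
  R = length (coprimePairs N)

  instance
    F≢0 : NonZero F
    F≢0 = N !≢0
    F²≢0 : NonZero (F * F)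
    F²≢0 = m*n≢0 F F
    Q≢0 : NonZero Q
    Q≢0 = m*n≢0 N N
    K≢0 : NonZero K
    K≢0 = m*n≢0 Q Q

  InRange : ℕ → Set
  InRange d = 1 ≤ d × d ≤ N

  cofactor : ℕ → ℕ
  -- A default value: the facts about `cofactor` concern arguments between 1 and `N`.
  cofactor zero    = 0
  cofactor (suc d) = F / suc d

  -- The division is exact because `d` divides `d !`, which divides `N !`.
  *-cofactor : ∀ {d} → InRange d → d * cofactor d ≡ F
  *-cofactor {suc d} (_ , d≤N) = m*[n/m]≡n (∣-trans (m∣m*n (d !)) (m≤n⇒m!∣n! d≤N))

  -- (c + kP) · n/d, with the denominator cleared by the factor (N!)².
  scaled : ℕ → ℕ → ℕ → ℕ → ℕ
  scaled c n d k = (c + k * P) * (n * (cofactor d * F))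

  scaled-positive : ∀ {c n d} k → 1 ≤ c → InRange n → InRange d → NonZero (scaled c n d k)
  scaled-positive {c} {n} {d} k 1≤c (1≤n , _) d∈ =
    m*n≢0 (c + k * P) (n * (cofactor d * F))
      {{>-nonZero (≤-trans 1≤c (m≤m+n c (k * P)))}}
      {{m*n≢0 n (cofactor d * F) {{>-nonZero 1≤n}} {{m*n≢0 (cofactor d) F {{cofactor≢0}}}}}}
    where
    cofactor≢0 : NonZero (cofactor d)
    cofactor≢0 = m*n≢0⇒n≢0 d {{subst NonZero (sym (*-cofactor d∈)) F≢0}}

  -- Multiplying by `d * d′` completes each cofactor to `F`; the factor `F * F` on both sides then
  -- cancels, leaving ordinary cross-multiplication.
  scaled-cross : ∀ {c n d c′ n′ d′} k k′ → InRange d → InRange d′ →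
                 scaled c n d k ≡ scaled c′ n′ d′ k′ →
                 (c + k * P) * (n * d′) ≡ (c′ + k′ * P) * (n′ * d)
  scaled-cross {c} {n} {d} {c′} {n′} {d′} k k′ d∈ d′∈ eq =
    *-cancelʳ-≡ _ _ (F * F) (begin
      (c + k * P) * (n * d′) * (F * F)
        ≡⟨ cong (λ z → (c + k * P) * (n * d′) * (z * F)) (*-cofactor d∈) ⟨
      (c + k * P) * (n * d′) * (d * cofactor d * F)
        ≡⟨ shuffle (c + k * P) n d d′ (cofactor d) F ⟩
      scaled c n d k * (d * d′)
        ≡⟨ cong (_* (d * d′)) eq ⟩
      scaled c′ n′ d′ k′ * (d * d′)
        ≡⟨ cong (scaled c′ n′ d′ k′ *_) (*-comm d d′) ⟩
      scaled c′ n′ d′ k′ * (d′ * d)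
        ≡⟨ shuffle (c′ + k′ * P) n′ d′ d (cofactor d′) F ⟨
      (c′ + k′ * P) * (n′ * d) * (d′ * cofactor d′ * F)
        ≡⟨ cong (λ z → (c′ + k′ * P) * (n′ * d) * (z * F)) (*-cofactor d′∈) ⟩
      (c′ + k′ * P) * (n′ * d) * (F * F) ∎)
    where
    open ≡-Reasoning
    shuffle : ∀ u n d d′ x F → u * (n * d′) * (d * x * F) ≡ u * (n * (x * F)) * (d * d′)
    shuffle = solve-∀

  product<T : ∀ {x y} → InRange x → InRange y → x * y < T
  product<T (_ , x≤N) (_ , y≤N) = s≤s (*-mono-≤ x≤N y≤N)

  -- All residues in play are below P, so an equality of vertices survives reduction modulo P.
  scaled-residue : ∀ {c n d c′ n′ d′} k k′ → c ≤ T → c′ ≤ T →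
                   InRange n → InRange d → InRange n′ → InRange d′ →
                   scaled c n d k ≡ scaled c′ n′ d′ k′ → c * (n * d′) ≡ c′ * (n′ * d)
  scaled-residue {c} {n} {d} {c′} {n′} {d′} k k′ c≤T c′≤T n∈ d∈ n′∈ d′∈ eq =
    residue-unique (k * (n * d′)) (k′ * (n′ * d))
      (≤-<-trans (*-monoˡ-≤ (n * d′) c≤T) (*-monoʳ-< T (product<T n∈ d′∈)))
      (≤-<-trans (*-monoˡ-≤ (n′ * d) c′≤T) (*-monoʳ-< T (product<T n′∈ d∈)))
      (trans (sym (expand c k P (n * d′)))
        (trans (scaled-cross {c} {n} {d} {c′} {n′} {d′} k k′ d∈ d′∈ eq) (expand c′ k′ P (n′ * d))))
    where
    expand : ∀ c k P X → (c + k * P) * X ≡ c * X + k * X * P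
    expand = solve-∀

  -- Modulo `P` the dilations reduce to the common factor `c`, which cancels, so the reduced
  -- fractions agree. Once they do, the unreduced equality returns `k`.
  scaled-injective : ∀ {c n d n′ d′} k k′ → 1 ≤ c → c ≤ T →
                     InRange n → InRange d → InRange n′ → InRange d′ →
                     Coprime n d → Coprime n′ d′ →
                     scaled c n d k ≡ scaled c n′ d′ k′ → (n ≡ n′ × d ≡ d′) × k ≡ k′
  scaled-injective {c} {n} {d} {n′} {d′} k k′ 1≤c c≤T n∈ d∈ n′∈ d′∈ cop cop′ eq
    with refl , refl ← cross-multiplication-injective {n} {d} {n′} {d′} cop cop′
           (*-cancelˡ-≡ _ _ c {{>-nonZero 1≤c}}
             (scaled-residue {c} {n} {d} {c} {n′} {d′} k k′ c≤T c≤T n∈ d∈ n′∈ d′∈ eq)) =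
    -- The cross-multiplied equality is used a second time, now with the same fraction on both
    -- sides, so that only `k * P` and `k′ * P` remain to compare.
    (refl , refl) , *-cancelʳ-≡ k k′ P (+-cancelˡ-≡ c _ _
      (*-cancelʳ-≡ _ _ (n * d) {{m*n≢0 n d {{>-nonZero (proj₁ n∈)}} {{>-nonZero (proj₁ d∈)}}}}
        (scaled-cross {c} {n} {d} {c} {n} {d} k k′ d∈ d∈ eq)))

  num den : Fin R → ℕ
  num i = proj₁ (lookup (coprimePairs N) i)
  den i = proj₂ (lookup (coprimePairs N) i)

  pair-spec : ∀ i → (InRange (num i) × InRange (den i)) × Coprime (num i) (den i)
  pair-spec i with i∈box , cop ← ∈-filter⁻ (uncurry coprime?) {xs = box N} (∈-lookup {xs = coprimePairs N} i) =
    ∈-box⁻ N i∈box , cop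

  num∈ : ∀ i → InRange (num i)
  num∈ i = proj₁ (proj₁ (pair-spec i))

  den∈ : ∀ i → InRange (den i)
  den∈ i = proj₂ (proj₁ (pair-spec i))

  num-den-coprime : ∀ i → Coprime (num i) (den i)
  num-den-coprime i = proj₂ (pair-spec i)

  pair-injective : ∀ {i j} → num i ≡ num j → den i ≡ den j → i ≡ j
  pair-injective eq₁ eq₂ = lookup-injective (coprimePairs-unique N) (cong₂ _,_ eq₁ eq₂)

  left right : Fin R → Fin K → ℕ
  left  i k = scaled 1 (num i) (den i) (toℕ k)
  right i k = scaled T (den i) (num i) (toℕ k)

  left-injective : ∀ {i k j l} → left i k ≡ left j l → i ≡ j × k ≡ l
  left-injective {i} {k} {j} {l} eq =
    let (eq₁ , eq₂) , eq₃ = scaled-injective {1} {num i} {den i} {num j} {den j} (toℕ k) (toℕ l)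
           (s≤s z≤n) (s≤s z≤n) (num∈ i) (den∈ i) (num∈ j) (den∈ j)
           (num-den-coprime i) (num-den-coprime j) eq
    in pair-injective eq₁ eq₂ , toℕ-injective eq₃

  right-injective : ∀ {i k j l} → right i k ≡ right j l → i ≡ j × k ≡ l
  right-injective {i} {k} {j} {l} eq =
    let (eq₁ , eq₂) , eq₃ = scaled-injective {T} {den i} {num i} {den j} {num j} (toℕ k) (toℕ l)
           (s≤s z≤n) ≤-refl (den∈ i) (num∈ i) (den∈ j) (num∈ j)
           (Coprimality.sym {num i} {den i} (num-den-coprime i))
           (Coprimality.sym {num j} {den j} (num-den-coprime j)) eq
    in pair-injective eq₂ eq₁ , toℕ-injective eq₃

  -- The residues 1 and `T` separate the sides: equality would force `num i * num j` to equal
  -- `T * (den j * den i)`, yet the first is below `T` and the second at least `T`.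
  left≢right : ∀ {i k j l} → left i k ≢ right j l
  left≢right {i} {k} {j} {l} eq = <-irrefl
    (trans (sym (*-identityˡ (num i * num j)))
      (scaled-residue {1} {num i} {den i} {T} {den j} {num j} (toℕ k) (toℕ l)
        (s≤s z≤n) ≤-refl (num∈ i) (den∈ i) (den∈ j) (num∈ j) eq))
    (<-≤-trans (product<T (num∈ i) (num∈ j))
      (m≤m*n T (den j * den i)
        {{m*n≢0 (den j) (den i) {{>-nonZero (proj₁ (den∈ j))}} {{>-nonZero (proj₁ (den∈ i))}}}}))

  open BipartiteBlocks R K left right
    (λ {i} {k} {j} {l} → left-injective {i} {k} {j} {l})
    (λ {i} {k} {j} {l} → right-injective {i} {k} {j} {l})
    (λ {i} {k} {j} {l} → left≢right {i} {k} {j} {l})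
    (λ i k → scaled-positive {1} {num i} {den i} (toℕ k) (s≤s z≤n) (num∈ i) (den∈ i))
    (λ i k → scaled-positive {T} {den i} {num i} (toℕ k) (s≤s z≤n) (den∈ i) (num∈ i))
    public

  -- Counting sums and products along the edges

  sumValue : Fin R × ℕ → ℕ
  sumValue (i , s) =
    cofactor (num i) * cofactor (den i) * (num i * num i + T * (den i * den i) + s * P)

  -- For fixed `i` the common difference `P` lets `k` and `l` enter only through one integer, so the
  -- `K * K` edges of a block share fewer than `2 * K * Q` sums.
  sum-formula : ∀ i k l → left i k + right i l ≡
    sumValue (i , toℕ k * (num i * num i) + toℕ l * (den i * den i))
  sum-formula i k l = begin
    left i k + right i l
      -- The outer `F` is split as `w * x′` in the left summand and as `v * x` in the right one;
      -- both summands then carry the factor `x′ * x`.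
      ≡⟨ cong₂ (λ y z → (1 + toℕ k * P) * (w * (x * y)) + (T + toℕ l * P) * (v * (x′ * z)))
           (*-cofactor (num∈ i)) (*-cofactor (den∈ i)) ⟨
    (1 + toℕ k * P) * (w * (x * (w * x′))) + (T + toℕ l * P) * (v * (x′ * (v * x)))
      ≡⟨ collect w v x x′ (toℕ k) (toℕ l) T P ⟩
    x′ * x * (w * w + T * (v * v) + (toℕ k * (w * w) + toℕ l * (v * v)) * P) ∎
    where
    open ≡-Reasoning
    w v x x′ : ℕ
    w = num i
    v = den i
    x = cofactor v
    x′ = cofactor w
    collect : ∀ w v x x′ k l T P →
      (1 + k * P) * (w * (x * (w * x′))) + (T + l * P) * (v * (x′ * (v * x)))
      ≡ x′ * x * (w * w + T * (v * v) + (k * (w * w) + l * (v * v)) * P)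
    collect = solve-∀

  productValue : Fin K × Fin K → ℕ
  productValue (k , l) = (1 + toℕ k * P) * (T + toℕ l * P) * (F * F * (F * F))

  -- The fractions are reciprocal: each of `num i` and `den i` meets its own cofactor and becomes
  -- `F`, so `i` disappears.
  product-formula : ∀ i k l → left i k * right i l ≡ productValue (k , l)
  product-formula i k l = begin
    left i k * right i l
      ≡⟨ shuffle (num i) (den i) (cofactor (den i)) (cofactor (num i)) (1 + toℕ k * P) (T + toℕ l * P) F ⟩
    (1 + toℕ k * P) * (T + toℕ l * P) * (num i * cofactor (num i) * (den i * cofactor (den i)) * (F * F))
      ≡⟨ cong₂ (λ y z → (1 + toℕ k * P) * (T + toℕ l * P) * (y * z * (F * F)))
           (*-cofactor (num∈ i)) (*-cofactor (den∈ i)) ⟩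
    (1 + toℕ k * P) * (T + toℕ l * P) * (F * F * (F * F)) ∎
    where
    open ≡-Reasoning
    shuffle : ∀ w v x x′ u u′ F → u * (w * (x * F)) * (u′ * (v * (x′ * F)))
              ≡ u * u′ * (w * x′ * (v * x) * (F * F))
    shuffle = solve-∀

  sumIndices : List (Fin R × ℕ)
  sumIndices = cartesianProduct (allFin R) (upTo (K * Q + K * Q))

  length-sumIndices : length sumIndices ≡ R * (K * Q + K * Q)
  length-sumIndices = trans (length-cartesianProduct (allFin R) (upTo (K * Q + K * Q)))
    (cong₂ _*_ (length-allFin R) (length-upTo (K * Q + K * Q)))

  sum∈ : ∀ i k l → (left i k + right i l) ∈ map sumValue sumIndices
  sum∈ i k l = subst (λ s → s ∈ map sumValue sumIndices) (sym (sum-formula i k l))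
    (∈-map⁺ sumValue
      -- Each half of the range `K * Q + K * Q` accommodates one term, an index below `K` times a
      -- square at most `Q`.
      (∈-cartesianProduct⁺ (∈-allFin i) (∈-upTo⁺ (+-mono-< (term< k (num∈ i)) (term< l (den∈ i))))))
    where
    term< : ∀ (k : Fin K) {x} → InRange x → toℕ k * (x * x) < K * Q
    term< k (_ , x≤N) = ≤-<-trans (*-monoʳ-≤ (toℕ k) (*-mono-≤ x≤N x≤N)) (*-monoˡ-< Q (toℕ<n k))

  card-sums : card (sumsAlong vertexSet graph) ≤ R * (K * Q + K * Q)
  card-sums = subst (card (sumsAlong vertexSet graph) ≤_)
    (trans (length-map sumValue sumIndices) length-sumIndices)
    (card≤length (alongEdges-⊆ _+_ sum∈))

  productIndices : List (Fin K × Fin K)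
  productIndices = cartesianProduct (allFin K) (allFin K)

  length-productIndices : length productIndices ≡ K * K
  length-productIndices = trans (length-cartesianProduct (allFin K) (allFin K))
    (cong₂ _*_ (length-allFin K) (length-allFin K))

  product∈ : ∀ i k l → (left i k * right i l) ∈ map productValue productIndices
  product∈ i k l = subst (λ p → p ∈ map productValue productIndices) (sym (product-formula i k l))
    (∈-map⁺ productValue (∈-cartesianProduct⁺ (∈-allFin k) (∈-allFin l)))

  card-products : card (prodsAlong vertexSet graph) ≤ K * K
  card-products = subst (card (prodsAlong vertexSet graph) ≤_)
    (trans (length-map productValue productIndices) length-productIndices)
    (card≤length (alongEdges-⊆ _*_ product∈))

  -- Comparison of the counts with the number of vertices

  R≤Q : R ≤ Q
  R≤Q = length-coprimePairs≤ N

  Q≤4R : Q ≤ 4 * R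
  Q≤4R = length-coprimePairs≥ N

  card-total : card (sumsAlong vertexSet graph) + card (prodsAlong vertexSet graph) ≤ 3 * (K * K)
  card-total = begin
    card (sumsAlong vertexSet graph) + card (prodsAlong vertexSet graph)
      ≤⟨ +-mono-≤ card-sums card-products ⟩
    R * (K * Q + K * Q) + K * K ≤⟨ +-monoˡ-≤ (K * K) (*-monoˡ-≤ (K * Q + K * Q) R≤Q) ⟩
    Q * (K * Q + K * Q) + K * K ≡⟨ collect Q ⟩
    3 * (K * K)                 ∎
    where
    open ≤-Reasoning
    collect : ∀ q → q * (q * q * q + q * q * q) + q * q * (q * q) ≡ 3 * (q * q * (q * q))
    collect = solve-∀

  N≤order : N ≤ order
  N≤order = begin
    N             ≤⟨ m≤m*n N N ⟩
    Q             ≤⟨ m≤m*n Q Q ⟩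
    K             ≤⟨ m≤n*m K R {{R≢0}} ⟩
    R * K         ≤⟨ m≤m+n (R * K) (R * K) ⟩
    R * K + R * K ∎
    where
    open ≤-Reasoning
    R≢0 : NonZero R
    R≢0 = m*n≢0⇒n≢0 4 {{>-nonZero (≤-trans (>-nonZero⁻¹ Q) Q≤4R)}}

  open +-*-Solver using (solve; _:+_; _:*_; _:^_; _:=_; con)

  -- Here `order` is `2RK` and there are `RK²` edges. The surplus `R²` in the fifth power is at most
  -- `Q² = K`, which supplies the missing factor of `(RK²)³`; the constant is `2⁵`.
  order^5≤ : order ^ 5 ≤ 32 * numEdges graph ^ 3
  order^5≤ = begin
    order ^ 5                            ≡⟨ expand R K ⟩
    32 * (R ^ 3 * K ^ 5) * (R * R)       ≤⟨ *-monoʳ-≤ (32 * (R ^ 3 * K ^ 5)) (*-mono-≤ R≤Q R≤Q) ⟩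
    32 * (R ^ 3 * K ^ 5) * K             ≡⟨ collect R K ⟩
    32 * (R * (K * K)) ^ 3               ≡⟨ cong (λ e → 32 * e ^ 3) numEdges-graph ⟨
    32 * numEdges graph ^ 3              ∎
    where
    open ≤-Reasoning
    expand : ∀ r k → (r * k + r * k) ^ 5 ≡ 32 * (r ^ 3 * k ^ 5) * (r * r)
    expand = solve 2 (λ r k →
      (r :* k :+ r :* k) :^ 5 := con 32 :* (r :^ 3 :* k :^ 5) :* (r :* r)) refl
    collect : ∀ r k → 32 * (r ^ 3 * k ^ 5) * k ≡ 32 * (r * (k * k)) ^ 3
    collect = solve 2 (λ r k →
      con 32 :* (r :^ 3 :* k :^ 5) :* k := con 32 :* (r :* (k :* k)) :^ 3) refl

  -- This direction needs many fractions: `K² = Q⁴` is at most `(4R)⁴`. The constant is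
  -- `3³ * 4⁴ / 2⁴ = 432`.
  card-total^3≤ : (card (sumsAlong vertexSet graph) + card (prodsAlong vertexSet graph)) ^ 3
                  ≤ 432 * order ^ 4
  card-total^3≤ = begin
    (card (sumsAlong vertexSet graph) + card (prodsAlong vertexSet graph)) ^ 3
      ≤⟨ ^-monoˡ-≤ 3 card-total ⟩
    (3 * (K * K)) ^ 3                            ≡⟨ split K ⟩
    27 * K ^ 4 * (K * K)
      ≤⟨ *-monoʳ-≤ (27 * K ^ 4) (*-mono-≤ (*-mono-≤ Q≤4R Q≤4R) (*-mono-≤ Q≤4R Q≤4R)) ⟩
    27 * K ^ 4 * (4 * R * (4 * R) * (4 * R * (4 * R))) ≡⟨ collect R K ⟩
    432 * order ^ 4                              ∎
    where
    open ≤-Reasoning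
    split : ∀ k → (3 * (k * k)) ^ 3 ≡ 27 * k ^ 4 * (k * k)
    split = solve 1 (λ k → (con 3 :* (k :* k)) :^ 3 := con 27 :* k :^ 4 :* (k :* k)) refl
    collect : ∀ r k → 27 * k ^ 4 * (4 * r * (4 * r) * (4 * r * (4 * r))) ≡ 432 * (r * k + r * k) ^ 4
    collect = solve 2 (λ r k →
      con 27 :* k :^ 4 :* (con 4 :* r :* (con 4 :* r) :* (con 4 :* r :* (con 4 :* r)))
        := con 432 :* (r :* k :+ r :* k) :^ 4) refl

theorem2p1 : ∃[ a ] ∃[ b ] (NonZero a × NonZero b ×
    (∀ (m₀ : ℕ) → ∃[ m ] ∃[ A ] ∃[ G ]
    (m₀ ≤ m
    × m ^ 5 ≤ a * (numEdges {m} G ^ 3 * ⌊log₂ m ⌋)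
    × (card (sumsAlong {m} A G) + card (prodsAlong A G)) ^ 3
    ≤ b * (m * ⌊log₂ m ⌋) ^ 4)))
theorem2p1 = 32 , 432 , _ , _ , λ m₀ →
  -- The shift by 2 gives `order` at least 2 as well as at least `m₀`; the floored logarithm is then
  -- at least 1, and inserting it on the right preserves both bounds.
  let open Construction (2 + m₀)
      log≢0 : NonZero ⌊log₂ order ⌋
      log≢0 = >-nonZero (⌊log₂⌋-mono-≤ (≤-trans (m≤m+n 2 m₀) N≤order))
  in order , vertexSet , graph
   , ≤-trans (m≤n+m m₀ 2) N≤order
   , ≤-trans order^5≤ (*-monoʳ-≤ 32 (m≤m*n (numEdges graph ^ 3) ⌊log₂ order ⌋ {{log≢0}}))
   , ≤-trans card-total^3≤ (*-monoʳ-≤ 432 (^-monoˡ-≤ 4 (m≤m*n order ⌊log₂ order ⌋ {{log≢0}})))
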